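{- Let $H$ be a connected line graph. Then $H$ is an $i$-graph if and only if $H$ does not contain the diamond $\mathfrak{D}$ as an induced subgraph.
   Context: All graphs are finite and simple. For a graph $G$, $i(G)$ is the minimum cardinality of an independent dominating set; such a set is an $i$-set. The $i$-graph $\mathcal{I}(G)$ has the $i$-sets of $G$ as vertices, with $X\sim Y$ iff $Y=(X\setminus\{u\})\cup\{v\}$ for some $u\in X$, $v\notin X$ with $uv\in E(G)$. A graph $H$ is an $i$-graph if $H\cong \mathcal{I}(G)$ for some graph $G$. The diamond $\mathfrak{D}$ is $K_4$ minus one edge. -}

module Defs where

open import Data.Nat using (ℕ; _≤_)
open import Data.Fin using (Fin; zero; suc; _<_)
open import Data.Bool using (Bool; true; false; T)
open import Data.Fin.Subset using (Subset; _∈_; _∉_; ∣_∣; ⁅_⁆; _∪_; _─_)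
open import Data.Product using (Σ; ∃; ∃-syntax; _×_; _,_)
open import Data.Sum using (_⊎_)
open import Relation.Nullary using (¬_)
open import Relation.Binary.PropositionalEquality using (_≡_; _≢_)
open import Function.Bundles using (_⇔_)

record Graph (n : ℕ) : Set₁ where
  field
    Adj   : Fin n → Fin n → Set
    sym   : ∀ {x y} → Adj x y → Adj y x
    irrefl : ∀ {x} → ¬ Adj x x
open Graph public

data Reach {n : ℕ} (G : Graph n) : Fin n → Fin n → Set where
  here : ∀ {x} → Reach G x x
  step : ∀ {x y z} → Adj G x y → Reach G y z → Reach G x z

Connected : ∀ {n} → Graph n → Set
Connected {n} G = Fin n × (∀ x y → Reach G x y)

-- H (on Fin n) is isomorphic to the graph whose vertex set is {a : A | V a}
-- and whose adjacency is R.
IsoTo : ∀ {n} {A : Set} → Graph n → (A → Set) → (A → A → Set) → Set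
IsoTo {n} {A} H V R =
  Σ (Fin n → A) λ f →
    (∀ x → V (f x)) ×
    (∀ x y → f x ≡ f y → x ≡ y) ×
    (∀ a → V a → ∃[ x ] f x ≡ a) ×
    (∀ x y → Adj H x y ⇔ R (f x) (f y))

IsEdge : ∀ {m} → Graph m → Fin m × Fin m → Set
IsEdge G (a , b) = a < b × Adj G a b

LineAdj : ∀ {m} → Fin m × Fin m → Fin m × Fin m → Set
LineAdj (a , b) (c , d) =
  (a , b) ≢ (c , d) × (a ≡ c ⊎ a ≡ d ⊎ b ≡ c ⊎ b ≡ d)

IsLineGraph : ∀ {n} → Graph n → Set₁
IsLineGraph H = Σ ℕ λ m → Σ (Graph m) λ G → IsoTo H (IsEdge G) LineAdj

Independent : ∀ {m} → Graph m → Subset m → Set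
Independent G S = ∀ x y → x ∈ S → y ∈ S → ¬ Adj G x y

Dominating : ∀ {m} → Graph m → Subset m → Set
Dominating G S = ∀ x → x ∈ S ⊎ (∃[ y ] (y ∈ S × Adj G x y))

IndepDom : ∀ {m} → Graph m → Subset m → Set
IndepDom G S = Independent G S × Dominating G S

IsISet : ∀ {m} → Graph m → Subset m → Set
IsISet G S = IndepDom G S × (∀ T → IndepDom G T → ∣ S ∣ ≤ ∣ T ∣)

IAdj : ∀ {m} → Graph m → Subset m → Subset m → Set
IAdj G X Y = ∃[ u ] ∃[ v ] (u ∈ X × v ∉ X × Adj G u v × Y ≡ (X ─ ⁅ u ⁆) ∪ ⁅ v ⁆)

IsIGraph : ∀ {n} → Graph n → Set₁
IsIGraph H = Σ ℕ λ m → Σ (Graph m) λ G → IsoTo H (IsISet G) (IAdj G)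

-- The diamond K4 - e on Fin 4: all pairs of distinct vertices adjacent
-- except the pair {0, 3}.
dadj : Fin 4 → Fin 4 → Bool
dadj zero zero = false
dadj zero (suc (suc (suc zero))) = false
dadj (suc (suc (suc zero))) zero = false
dadj (suc zero) (suc zero) = false
dadj (suc (suc zero)) (suc (suc zero)) = false
dadj (suc (suc (suc zero))) (suc (suc (suc zero))) = false
dadj _ _ = true

DiamondAdj : Fin 4 → Fin 4 → Set
DiamondAdj i j = T (dadj i j)

ContainsInducedDiamond : ∀ {n} → Graph n → Set
ContainsInducedDiamond {n} H =
  Σ (Fin 4 → Fin n) λ f →
    (∀ i j → f i ≡ f j → i ≡ j) ×
    (∀ i j → Adj H (f i) (f j) ⇔ DiamondAdj i j)

{-# OPTIONS --safe #-}
-- Three pairwise adjacent i-sets arise from one of them, B, by removing the same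
-- vertex u.  If B ∖ {u} ∪ {v} and B ∖ {u} ∪ {v'} are distinct i-sets, then v' is
-- dominated by the first one, necessarily through v, so these two are adjacent:
-- a diamond cannot be induced.
-- Conversely let H be the line graph of F.  In the complement of a graph without
-- isolated vertices that has a maximal clique of size 2, the i-sets are precisely
-- the maximal cliques of size 2, so a triangle-free F yields H as the i-graph of
-- its complement.  If F has a triangle, a further edge at one of its corners gives
-- a diamond, so by connectedness H is complete, and then H is its own i-graph.
module Submission where

open import Defs
open import Data.Empty using (⊥-elim)
open import Data.Fin using (Fin; zero; suc; _<_; _↑ʳ_)
open import Data.Fin.Properties using (_≟_; any?; <-cmp; <-asym; <-irrefl; ↑ʳ-injective)
open import Data.Fin.Subset using (Subset; _∈_; _∉_; _⊆_; ∣_∣; ⁅_⁆; _∪_; _─_; inside)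
open import Data.Fin.Subset.Properties using
  ( _∈?_; x∈⁅x⁆; x∈⁅y⁆⇒x≡y; x≢y⇒x∉⁅y⁆; ∣⁅x⁆∣≡1; ⊆-antisym; p⊆q⇒∣p∣≤∣q∣; p⊂q⇒∣p∣<∣q∣
  ; ∪-identityˡ; ∪-identityʳ; x∈p∪q⁻; x∈p∪q⁺; x∈p∧x∉q⇒x∈p─q; p─q⊆p )
open import Data.Nat using (ℕ; suc; _+_; _≤_; s<s)
open import Data.Nat.Properties using (≤-trans; ≤-reflexive; <⇒≱)
open import Data.Product using (Σ; ∃-syntax; _×_; _,_; proj₁; proj₂)
open import Data.Sum using (_⊎_; inj₁; inj₂; [_,_]′)
open import Data.Unit using (tt)
open import Data.Vec using (lookup; []; _∷_; here; there)
open import Function using (_∘_)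
open import Function.Bundles using (_⇔_; mk⇔; module Equivalence)
open import Relation.Binary using (tri<; tri≈; tri>)
open import Relation.Binary.PropositionalEquality
  using (_≡_; _≢_; refl; trans; cong; cong₂; subst; ≢-sym) renaming (sym to ≡-sym)
open import Relation.Nullary using (¬_; Dec; yes; no)
open import Relation.Nullary.Decidable using (_×-dec_; _⊎-dec_; ¬?; decidable-stable)

open Equivalence using (to; from)

-- Subsets

x∈p─q⇒x∉q : ∀ {n} {x : Fin n} (p q : Subset n) → x ∈ p ─ q → x ∉ q
x∈p─q⇒x∉q (_ ∷ _) (inside ∷ _) () here
x∈p─q⇒x∉q (_ ∷ p) (_ ∷ q) (there x∈) (there x∈q) = x∈p─q⇒x∉q p q x∈ x∈q

pair : ∀ {n} → Fin n → Fin n → Subset n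
pair a b = ⁅ a ⁆ ∪ ⁅ b ⁆

∈pair⁺ : ∀ {n} {x a b : Fin n} → x ≡ a ⊎ x ≡ b → x ∈ pair a b
∈pair⁺ (inj₁ refl) = x∈p∪q⁺ (inj₁ (x∈⁅x⁆ _))
∈pair⁺ (inj₂ refl) = x∈p∪q⁺ (inj₂ (x∈⁅x⁆ _))

∈pair⁻ : ∀ {n} {x a b : Fin n} → x ∈ pair a b → x ≡ a ⊎ x ≡ b
∈pair⁻ {a = a} {b} x∈ with x∈p∪q⁻ ⁅ a ⁆ ⁅ b ⁆ x∈
... | inj₁ h = inj₁ (x∈⁅y⁆⇒x≡y a h)
... | inj₂ h = inj₂ (x∈⁅y⁆⇒x≡y b h)

pair⊆ : ∀ {n} {a b : Fin n} {S : Subset n} → a ∈ S → b ∈ S → pair a b ⊆ S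
pair⊆ a∈S b∈S x∈ with ∈pair⁻ x∈
... | inj₁ refl = a∈S
... | inj₂ refl = b∈S

∣pair∣≡2 : ∀ {n} {a b : Fin n} → a ≢ b → ∣ pair a b ∣ ≡ 2
∣pair∣≡2 {a = zero} {zero} a≢b = ⊥-elim (a≢b refl)
∣pair∣≡2 {a = zero} {suc b} _ = cong suc (trans (cong ∣_∣ (∪-identityˡ ⁅ b ⁆)) (∣⁅x⁆∣≡1 b))
∣pair∣≡2 {a = suc a} {zero} _ = cong suc (trans (cong ∣_∣ (∪-identityʳ ⁅ a ⁆)) (∣⁅x⁆∣≡1 a))
∣pair∣≡2 {a = suc a} {suc b} a≢b = ∣pair∣≡2 (a≢b ∘ cong suc)

∣pair∣≤ : ∀ {n} {a b x y : Fin n} {T : Subset n} → a ≢ b → x ≢ y → x ∈ T → y ∈ T →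
  ∣ pair a b ∣ ≤ ∣ T ∣
∣pair∣≤ a≢b x≢y x∈T y∈T =
  ≤-trans (≤-reflexive (trans (∣pair∣≡2 a≢b) (≡-sym (∣pair∣≡2 x≢y)))) (p⊆q⇒∣p∣≤∣q∣ (pair⊆ x∈T y∈T))

-- The bound 2 is written as the size of another pair, the form in which minimality of an i-set
-- delivers it. A further element of `T` would make `pair x y` a proper, hence strictly smaller,
-- subset.
≡pair : ∀ {n} {a b x y : Fin n} {T : Subset n} → a ≢ b → x ≢ y → x ∈ T → y ∈ T →
  ∣ T ∣ ≤ ∣ pair a b ∣ → T ≡ pair x y
≡pair {x = x} {y} {T} a≢b x≢y x∈T y∈T ∣T∣≤ = ⊆-antisym T⊆ (pair⊆ x∈T y∈T)
  where
  T⊆ : T ⊆ pair x y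
  T⊆ {z} z∈T with z ∈? pair x y
  ... | yes z∈ = z∈
  ... | no z∉ = ⊥-elim (<⇒≱ (p⊂q⇒∣p∣<∣q∣ (pair⊆ x∈T y∈T , z , z∈T , z∉))
    (≤-trans ∣T∣≤ (≤-reflexive (trans (∣pair∣≡2 a≢b) (≡-sym (∣pair∣≡2 x≢y))))))

swap : ∀ {n} → Subset n → Fin n → Fin n → Subset n
swap X u v = (X ─ ⁅ u ⁆) ∪ ⁅ v ⁆

module _ {n} {X : Subset n} {u v : Fin n} where

  ∈swap-old : ∀ {w} → w ∈ X → w ≢ u → w ∈ swap X u v
  ∈swap-old w∈X w≢u = x∈p∪q⁺ (inj₁ (x∈p∧x∉q⇒x∈p─q w∈X (x≢y⇒x∉⁅y⁆ w≢u)))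

  ∈swap-new : v ∈ swap X u v
  ∈swap-new = x∈p∪q⁺ (inj₂ (x∈⁅x⁆ v))

  ∈swap⁻ : ∀ {w} → w ∈ swap X u v → (w ∈ X × w ≢ u) ⊎ w ≡ v
  ∈swap⁻ {w} w∈ with x∈p∪q⁻ (X ─ ⁅ u ⁆) ⁅ v ⁆ w∈
  ... | inj₂ h = inj₂ (x∈⁅y⁆⇒x≡y v h)
  ... | inj₁ h = inj₁ (p─q⊆p X ⁅ u ⁆ h , λ { refl → x∈p─q⇒x∉q X ⁅ u ⁆ h (x∈⁅x⁆ u) })

  ∈swap⁺ : ∀ {w} → (w ∈ X × w ≢ u) ⊎ w ≡ v → w ∈ swap X u v
  ∈swap⁺ (inj₁ (w∈X , w≢u)) = ∈swap-old w∈X w≢u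
  ∈swap⁺ (inj₂ refl) = ∈swap-new

-- The first exchange brings `v` in and the second takes it out again; since `v ∉ X`, that removal
-- loses nothing of `X`.
swap-swap : ∀ {n} {X : Subset n} {u v v′} → v ∉ X → swap (swap X u v) v v′ ≡ swap X u v′
swap-swap {X = X} {u} {v} {v′} v∉X = ⊆-antisym ⊆₁ ⊆₂
  where
  ⊆₁ : swap (swap X u v) v v′ ⊆ swap X u v′
  ⊆₁ w∈ with ∈swap⁻ w∈
  ... | inj₂ w≡v′ = ∈swap⁺ (inj₂ w≡v′)
  ... | inj₁ (w∈′ , w≢v) with ∈swap⁻ w∈′
  ...   | inj₁ h = ∈swap⁺ (inj₁ h)
  ...   | inj₂ w≡v = ⊥-elim (w≢v w≡v)
  ⊆₂ : swap X u v′ ⊆ swap (swap X u v) v v′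
  ⊆₂ w∈ with ∈swap⁻ w∈
  ... | inj₂ w≡v′ = ∈swap⁺ (inj₂ w≡v′)
  ... | inj₁ h@(w∈X , _) = ∈swap-old (∈swap⁺ (inj₁ h)) λ { refl → v∉X w∈X }

swap-pair : ∀ {n} {a b c : Fin n} → a ≢ b → swap (pair a b) b c ≡ pair a c
swap-pair {a = a} {b} {c} a≢b = ⊆-antisym ⊆₁ (pair⊆ (∈swap-old (∈pair⁺ (inj₁ refl)) a≢b) ∈swap-new)
  where
  ⊆₁ : swap (pair a b) b c ⊆ pair a c
  ⊆₁ w∈ with ∈swap⁻ w∈
  ... | inj₂ w≡c = ∈pair⁺ (inj₂ w≡c)
  ... | inj₁ (w∈′ , w≢b) with ∈pair⁻ w∈′
  ...   | inj₁ w≡a = ∈pair⁺ (inj₁ w≡a)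
  ...   | inj₂ w≡b = ⊥-elim (w≢b w≡b)

-- i-graphs contain no induced diamond

module _ {m} (G : Graph m) where

  -- If `u` and `u′` differed, then `u` would lie in `A` but not in `C`, and `u′` in `C` but not in
  -- `A`. The exchange from `C` to `A` would thus be along an edge from `u′` to `u`, both members of
  -- the independent set `B`.
  triangle-same-removed : ∀ {B C A} ((u , _) : IAdj G B C) ((u′ , _) : IAdj G B A) →
    IAdj G C A → Independent G B → u ≡ u′
  triangle-same-removed {B} {C} {A} (u , v , u∈B , v∉B , _ , C≡) (u′ , v′ , u′∈B , v′∉B , _ , A≡)
    (s , t , s∈C , t∉C , s~t , A≡′) indep = decidable-stable (u ≟ u′) absurd
    where
    u∉C : u ∉ C
    u∉C u∈C with ∈swap⁻ (subst (u ∈_) C≡ u∈C)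
    ... | inj₁ (_ , u≢u) = u≢u refl
    ... | inj₂ refl = v∉B u∈B
    u′∉A : u′ ∉ A
    u′∉A u′∈A with ∈swap⁻ (subst (u′ ∈_) A≡ u′∈A)
    ... | inj₁ (_ , u≢u) = u≢u refl
    ... | inj₂ refl = v′∉B u′∈B
    absurd : ¬ u ≢ u′
    absurd u≢u′ = indep u′ u u′∈B u∈B (subst (λ a → Adj G a u) s≡u′ (subst (Adj G s) (≡-sym u≡t) s~t))
      where
      u≡t : u ≡ t
      u≡t with ∈swap⁻ (subst (u ∈_) A≡′ (subst (u ∈_) (≡-sym A≡) (∈swap-old u∈B u≢u′)))
      ... | inj₁ (u∈C , _) = ⊥-elim (u∉C u∈C)
      ... | inj₂ h = h
      s≡u′ : s ≡ u′
      s≡u′ = decidable-stable (s ≟ u′) λ s≢u′ → u′∉A (subst (u′ ∈_) (≡-sym A≡′)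
        (∈swap-old (subst (u′ ∈_) (≡-sym C≡) (∈swap-old u′∈B (≢-sym u≢u′))) (≢-sym s≢u′)))

  same-removed⇒IAdj : ∀ {B A D} ((u , _) : IAdj G B A) ((u′ , _) : IAdj G B D) → u ≡ u′ →
    Dominating G A → Independent G D → A ≢ D → IAdj G A D
  same-removed⇒IAdj {B} {A} {D} (u , v , u∈B , v∉B , _ , A≡) (_ , v′ , _ , v′∉B , _ , D≡) refl
    dom indep A≢D = v , v′ , subst (v ∈_) (≡-sym A≡) ∈swap-new , v′∉A , v~v′ ,
      trans D≡ (trans (≡-sym (swap-swap v∉B)) (cong (λ X → swap X v v′) (≡-sym A≡)))
    where
    v≢v′ : v ≢ v′
    v≢v′ refl = A≢D (trans A≡ (≡-sym D≡))
    v′∉A : v′ ∉ A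
    v′∉A v′∈A with ∈swap⁻ (subst (v′ ∈_) A≡ v′∈A)
    ... | inj₁ (v′∈B , _) = v′∉B v′∈B
    ... | inj₂ refl = v≢v′ refl
    v~v′ : Adj G v v′
    v~v′ with dom v′
    ... | inj₁ v′∈A = ⊥-elim (v′∉A v′∈A)
    ... | inj₂ (y , y∈A , v′~y) with ∈swap⁻ (subst (y ∈_) A≡ y∈A)
    ...   | inj₂ refl = sym G v′~y
    -- A dominator of `v′` left over from `B` also lies in `D`, together with its neighbour `v′`.
    ...   | inj₁ (y∈B , y≢u) = ⊥-elim (indep v′ y (subst (v′ ∈_) (≡-sym D≡) ∈swap-new)
              (subst (y ∈_) (≡-sym D≡) (∈swap-old y∈B y≢u)) v′~y)

-- The triangles `b c a` and `b c e` share the edge `b c`, so the same vertex leaves the i-set of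
-- `b` on the way to each of the other three. This makes the i-sets of `a` and `e` adjacent, while
-- `DiamondAdj a e` is empty.
IGraph⇒diamond-free : ∀ {n} {H : Graph n} → IsIGraph H → ¬ ContainsInducedDiamond H
IGraph⇒diamond-free (_ , G , φ , φ-iset , φ-inj , _ , φ-adj) (d , d-inj , d-adj) =
  to (d-adj a e) (from (φ-adj (d a) (d e)) (same-removed⇒IAdj G (adj b a tt) (adj b e tt)
    (trans (≡-sym (same-removed a tt tt)) (same-removed e tt tt))
    (proj₂ (proj₁ (φ-iset (d a)))) (indep e) (λ eq → contra (d-inj a e (φ-inj _ _ eq)))))
  where
  a b c e : Fin 4
  a = zero
  b = suc zero
  c = suc (suc zero)
  e = suc (suc (suc zero))
  indep : ∀ i → Independent G (φ (d i))
  indep i = proj₁ (proj₁ (φ-iset (d i)))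
  adj : ∀ i j → DiamondAdj i j → IAdj G (φ (d i)) (φ (d j))
  adj i j h = to (φ-adj (d i) (d j)) (from (d-adj i j) h)
  same-removed : ∀ i (h : DiamondAdj b i) → DiamondAdj c i → proj₁ (adj b c tt) ≡ proj₁ (adj b i h)
  same-removed i h h′ = triangle-same-removed G (adj b c tt) (adj b i h) (adj c i h′) (indep b)
  contra : a ≢ e
  contra ()

-- The complement of a graph

module _ {k} (F : Graph k) where

  complement : Graph k
  complement = record
    { Adj = λ u v → u ≢ v × ¬ Adj F u v
    ; sym = λ (u≢v , u≁v) → ≢-sym u≢v , u≁v ∘ sym F
    ; irrefl = λ (u≢u , _) → u≢u refl
    }

  -- An edge in no triangle, that is, a maximal clique of size 2.
  MaxEdge : Fin k → Fin k → Set
  MaxEdge u v = Adj F u v × (∀ w → Adj F u w → ¬ Adj F v w)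

  MaxEdge⇒≢ : ∀ {u v} → MaxEdge u v → u ≢ v
  MaxEdge⇒≢ (u~v , _) refl = irrefl F u~v

module _ {k} (F : Graph k) (adj? : ∀ u v → Dec (Adj F u v)) where

  -- Cliques of `F` are independent in the complement, and a vertex left undominated there would be
  -- a common neighbour of `u` and `v` in `F`.
  MaxEdge⇒IndepDom : ∀ {u v} → MaxEdge F u v → IndepDom (complement F) (pair u v)
  MaxEdge⇒IndepDom {u} {v} (u~v , maximal) = indep , dom
    where
    indep : Independent (complement F) (pair u v)
    indep x y x∈ y∈ (x≢y , x≁y) with ∈pair⁻ x∈ | ∈pair⁻ y∈
    ... | inj₁ refl | inj₁ refl = x≢y refl
    ... | inj₁ refl | inj₂ refl = x≁y u~v
    ... | inj₂ refl | inj₁ refl = x≁y (sym F u~v)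
    ... | inj₂ refl | inj₂ refl = x≢y refl
    dom : Dominating (complement F) (pair u v)
    dom w with w ∈? pair u v | adj? u w
    ... | yes w∈ | _ = inj₁ w∈
    ... | no w∉ | no u≁w = inj₂ (u , ∈pair⁺ (inj₁ refl) , (λ w≡u → w∉ (∈pair⁺ (inj₁ w≡u))) , u≁w ∘ sym F)
    ... | no w∉ | yes u~w = inj₂ (v , ∈pair⁺ (inj₂ refl) , (λ w≡v → w∉ (∈pair⁺ (inj₂ w≡v))) ,
          λ w~v → maximal w u~w (sym F w~v))

  module _ (neighbour : ∀ u → ∃[ v ] Adj F u v) where

    -- Dominating the given vertex yields a first member `x`. A neighbour of `x` in `F` is not
    -- dominated by `x` in the complement, so it forces a second member.
    IndepDom⇒two : ∀ {T} → Fin k → IndepDom (complement F) T → ∃[ x ] ∃[ y ] (x ≢ y × x ∈ T × y ∈ T)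
    IndepDom⇒two {T} u (_ , dom) = x , distinct (dom y)
      where
      member : ∀ w → w ∈ T ⊎ (∃[ z ] (z ∈ T × Adj (complement F) w z)) → ∃[ z ] z ∈ T
      member w (inj₁ w∈T) = w , w∈T
      member w (inj₂ (z , z∈T , _)) = z , z∈T
      x = proj₁ (member u (dom u))
      x∈T = proj₂ (member u (dom u))
      y = proj₁ (neighbour x)
      x~y = proj₂ (neighbour x)
      distinct : y ∈ T ⊎ (∃[ z ] (z ∈ T × Adj (complement F) y z)) → ∃[ z ] (x ≢ z × x ∈ T × z ∈ T)
      distinct (inj₁ y∈T) = y , (λ x≡y → irrefl F (subst (Adj F x) (≡-sym x≡y) x~y)) , x∈T , y∈T
      distinct (inj₂ (z , z∈T , _ , y≁z)) =
        z , (λ x≡z → y≁z (subst (Adj F y) x≡z (sym F x~y))) , x∈T , z∈T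

    MaxEdge⇒ISet : ∀ {u v} → MaxEdge F u v → IsISet (complement F) (pair u v)
    MaxEdge⇒ISet {u} e = MaxEdge⇒IndepDom e , λ T T-dom →
      let (x , y , x≢y , x∈T , y∈T) = IndepDom⇒two u T-dom in ∣pair∣≤ (MaxEdge⇒≢ F e) x≢y x∈T y∈T

    -- The given maximal edge bounds the size of `T` by 2, so `T` is a pair. A common neighbour in
    -- `F` of its two members would be undominated in the complement.
    ISet⇒MaxEdge : ∀ {u v} → MaxEdge F u v → ∀ {T} → IsISet (complement F) T →
      ∃[ x ] ∃[ y ] (MaxEdge F x y × T ≡ pair x y)
    ISet⇒MaxEdge {u} {v} e {T} (T-dom@(indep , dom) , minimal) = x , y , (x~y , maximal) , T≡
      where
      two = IndepDom⇒two u T-dom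
      x = proj₁ two
      y = proj₁ (proj₂ two)
      x≢y = proj₁ (proj₂ (proj₂ two))
      x∈T = proj₁ (proj₂ (proj₂ (proj₂ two)))
      y∈T = proj₂ (proj₂ (proj₂ (proj₂ two)))
      T≡ : T ≡ pair x y
      T≡ = ≡pair (MaxEdge⇒≢ F e) x≢y x∈T y∈T (minimal _ (MaxEdge⇒IndepDom e))
      x~y : Adj F x y
      x~y = decidable-stable (adj? x y) λ x≁y → indep x y x∈T y∈T (x≢y , x≁y)
      maximal : ∀ w → Adj F x w → ¬ Adj F y w
      maximal w x~w y~w with dom w
      ... | inj₁ w∈T with ∈pair⁻ (subst (w ∈_) T≡ w∈T)
      ...   | inj₁ w≡x = irrefl F (subst (Adj F x) w≡x x~w)
      ...   | inj₂ w≡y = irrefl F (subst (Adj F y) w≡y y~w)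
      maximal w x~w y~w | inj₂ (z , z∈T , _ , w≁z) with ∈pair⁻ (subst (z ∈_) T≡ z∈T)
      ...   | inj₁ refl = w≁z (sym F x~w)
      ...   | inj₂ refl = w≁z (sym F y~w)

-- Complete graphs

-- The i-sets of a nonempty complete graph are its singletons, and exchanging one singleton for
-- another follows the edge between their elements.
complete⇒IGraph : ∀ {n} (H : Graph n) → Fin n → (∀ x y → x ≢ y → Adj H x y) → IsIGraph H
complete⇒IGraph {n} H x₀ complete = n , H , ⁅_⁆ , iset , inj , surj , λ x y → mk⇔ adj⁺ adj⁻
  where
  member : ∀ {T} → Dominating H T → ∃[ y ] y ∈ T
  member dom with dom x₀
  ... | inj₁ x₀∈T = x₀ , x₀∈T
  ... | inj₂ (y , y∈T , _) = y , y∈T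
  ≡⁅⁆ : ∀ {T} y → y ∈ T → Independent H T → T ≡ ⁅ y ⁆
  ≡⁅⁆ {T} y y∈T indep = ⊆-antisym
    (λ {z} z∈T → subst (_∈ ⁅ y ⁆)
      (decidable-stable (y ≟ z) λ y≢z → indep y z y∈T z∈T (complete y z y≢z)) (x∈⁅x⁆ y))
    (λ z∈ → subst (_∈ T) (≡-sym (x∈⁅y⁆⇒x≡y y z∈)) y∈T)
  iset : ∀ x → IsISet H ⁅ x ⁆
  iset x = (indep , dom) , λ T (T-indep , T-dom) → let (y , y∈T) = member T-dom in
      ≤-reflexive (trans (∣⁅x⁆∣≡1 x) (≡-sym (trans (cong ∣_∣ (≡⁅⁆ y y∈T T-indep)) (∣⁅x⁆∣≡1 y))))
    where
    indep : Independent H ⁅ x ⁆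
    indep y z y∈ z∈ y~z with x∈⁅y⁆⇒x≡y x y∈ | x∈⁅y⁆⇒x≡y x z∈
    ... | refl | refl = irrefl H y~z
    dom : Dominating H ⁅ x ⁆
    dom z with z ≟ x
    ... | yes refl = inj₁ (x∈⁅x⁆ x)
    ... | no z≢x = inj₂ (x , x∈⁅x⁆ x , complete z x z≢x)
  inj : ∀ x y → ⁅ x ⁆ ≡ ⁅ y ⁆ → x ≡ y
  inj x y eq = x∈⁅y⁆⇒x≡y y (subst (x ∈_) eq (x∈⁅x⁆ x))
  surj : ∀ T → IsISet H T → ∃[ x ] ⁅ x ⁆ ≡ T
  surj T ((indep , dom) , _) = let (y , y∈T) = member dom in y , ≡-sym (≡⁅⁆ y y∈T indep)
  adj⁺ : ∀ {x y} → Adj H x y → IAdj H ⁅ x ⁆ ⁅ y ⁆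
  adj⁺ {x} {y} x~y = x , y , x∈⁅x⁆ x , x≢y⇒x∉⁅y⁆ (λ { refl → irrefl H x~y }) , x~y ,
    ⊆-antisym (λ z∈ → ∈swap⁺ {X = ⁅ x ⁆} (inj₂ (x∈⁅y⁆⇒x≡y y z∈))) ⊆₂
    where
    ⊆₂ : swap ⁅ x ⁆ x y ⊆ ⁅ y ⁆
    ⊆₂ z∈ with ∈swap⁻ z∈
    ... | inj₁ (z∈⁅x⁆ , z≢x) = ⊥-elim (z≢x (x∈⁅y⁆⇒x≡y x z∈⁅x⁆))
    ... | inj₂ refl = x∈⁅x⁆ y
  adj⁻ : ∀ {x y} → IAdj H ⁅ x ⁆ ⁅ y ⁆ → Adj H x y
  adj⁻ {x} {y} (u , v , u∈ , v∉ , u~v , eq)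
    with x∈⁅y⁆⇒x≡y x u∈ | x∈⁅y⁆⇒x≡y y (subst (v ∈_) (≡-sym eq) (∈swap-new {X = ⁅ x ⁆}))
  ... | refl | refl = u~v

-- Line graphs

-- The graph whose line graph is `H`, given as a list of edges: the vertex `x` of `H` is the edge
-- with ends `p x` and `q x`. Ordering the ends gives each edge a single representation.
record Root {n} (H : Graph n) (k : ℕ) : Set where
  field
    p q : Fin n → Fin k
    p<q : ∀ x → p x < q x
    injective : ∀ {x y} → p x ≡ p y → q x ≡ q y → x ≡ y

  At : Fin k → Fin n → Set
  At u x = u ≡ p x ⊎ u ≡ q x

  field
    adj : ∀ x y → Adj H x y ⇔ (x ≢ y × ∃[ u ] (At u x × At u y))

  Joins : Fin n → Fin k → Fin k → Set
  Joins x u v = At u x × At v x × u ≢ v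

  joins-sym : ∀ {x u v} → Joins x u v → Joins x v u
  joins-sym (u-at , v-at , u≢v) = v-at , u-at , ≢-sym u≢v

  joins-ends : ∀ x → Joins x (p x) (q x)
  joins-ends x = inj₁ refl , inj₂ refl , λ p≡q → <-irrefl p≡q (p<q x)

  other-end : ∀ {u x} → At u x → ∃[ v ] Joins x u v
  other-end {x = x} (inj₁ refl) = q x , joins-ends x
  other-end {x = x} (inj₂ refl) = p x , joins-sym (joins-ends x)

  at⇒end : ∀ {x u v w} → Joins x u v → At w x → w ≡ u ⊎ w ≡ v
  at⇒end (inj₁ refl , _         , _) (inj₁ refl) = inj₁ refl
  at⇒end (inj₂ refl , _         , _) (inj₂ refl) = inj₁ refl
  at⇒end (_         , inj₁ refl , _) (inj₁ refl) = inj₂ refl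
  at⇒end (_         , inj₂ refl , _) (inj₂ refl) = inj₂ refl
  at⇒end (inj₁ refl , inj₁ refl , u≢v) (inj₂ refl) = ⊥-elim (u≢v refl)
  at⇒end (inj₂ refl , inj₂ refl , u≢v) (inj₁ refl) = ⊥-elim (u≢v refl)

  sorted-ends : ∀ {x u v} → Joins x u v → u < v → p x ≡ u × q x ≡ v
  sorted-ends (inj₁ refl , inj₁ refl , u≢v) _ = ⊥-elim (u≢v refl)
  sorted-ends (inj₁ refl , inj₂ refl , _) _ = refl , refl
  sorted-ends {x} (inj₂ refl , inj₁ refl , _) u<v = ⊥-elim (<-asym u<v (p<q x))
  sorted-ends (inj₂ refl , inj₂ refl , u≢v) _ = ⊥-elim (u≢v refl)

  private
    unique-< : ∀ {x y u v} → Joins x u v → Joins y u v → u < v → x ≡ y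
    unique-< jx jy u<v with sorted-ends jx u<v | sorted-ends jy u<v
    ... | p≡ , q≡ | p≡′ , q≡′ = injective (trans p≡ (≡-sym p≡′)) (trans q≡ (≡-sym q≡′))

  -- Sorting `u` and `v` identifies them with the values of `p` and `q`, to which `injective`
  -- applies.
  unique : ∀ {x y u v} → Joins x u v → Joins y u v → x ≡ y
  unique {u = u} {v} jx@(_ , _ , u≢v) jy with <-cmp u v
  ... | tri< u<v _ _ = unique-< jx jy u<v
  ... | tri≈ _ u≡v _ = ⊥-elim (u≢v u≡v)
  ... | tri> _ _ v<u = unique-< (joins-sym jx) (joins-sym jy) v<u

  meet⇒adj : ∀ {x y u v w} → Joins x u v → Joins y u w → v ≢ w → Adj H x y
  meet⇒adj {x} {y} jx@(u-at-x , v-at-x , u≢v) jy@(u-at-y , _ , _) v≢w =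
    from (adj x y) ((λ { refl → [ u≢v ∘ ≡-sym , v≢w ]′ (at⇒end jy v-at-x) }) , _ , u-at-x , u-at-y)

  -- Adjacency in an arbitrary `Graph` need not be decidable; here it is a search through the
  -- finitely many vertices of `H`.
  root : Graph k
  root = record
    { Adj = λ u v → ∃[ x ] Joins x u v
    ; sym = λ (x , j) → x , joins-sym j
    ; irrefl = λ (_ , _ , _ , u≢u) → u≢u refl
    }

  at? : ∀ u x → Dec (At u x)
  at? u x = (u ≟ p x) ⊎-dec (u ≟ q x)

  root-adj? : ∀ u v → Dec (Adj root u v)
  root-adj? u v = any? λ x → at? u x ×-dec (at? v x ×-dec ¬? (u ≟ v))

  TriangleFree : Set
  TriangleFree = ∀ u v w → Adj root u v → Adj root u w → ¬ Adj root v w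

  Lone : Fin k → Set
  Lone u = ¬ (∃[ v ] Adj root u v)

  -- On a nonempty vertex set this amounts to at least three isolated vertices: one remains after
  -- any two are set aside.
  ThreeLone : Set
  ThreeLone = ∀ u v → ∃[ w ] (Lone w × w ≢ u × w ≢ v)

-- Shifting all ends by 3 adds the vertices 0, 1, 2, which lie on no edge, and leaves the line graph
-- unchanged.
LineGraph⇒Root : ∀ {n} {H : Graph n} → IsLineGraph H → ∃[ k ] Σ (Root H k) Root.ThreeLone
LineGraph⇒Root {H = H} (m , F , f , f-edge , f-inj , _ , f-adj) = 3 + m , record
  { p = λ x → 3 ↑ʳ proj₁ (f x)
  ; q = λ x → 3 ↑ʳ proj₂ (f x)
  ; p<q = λ x → s<s (s<s (s<s (proj₁ (f-edge x))))
  ; injective = λ {x} {y} p≡ q≡ → f-inj x y (cong₂ _,_ (unshift p≡) (unshift q≡))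
  ; adj = λ x y → mk⇔
      (λ x~y → let (f≢ , s) = to (f-adj x y) x~y in (λ x≡y → f≢ (cong f x≡y)) , common s)
      (λ (x≢y , u , u-at-x , u-at-y) → from (f-adj x y) (x≢y ∘ f-inj x y , shared u-at-x u-at-y))
  } , λ u v → let (w , w≢ , w≢u , w≢v) = third u v in
    w , (λ (_ , _ , w-at , _) → [ w≢ _ , w≢ _ ]′ w-at) , w≢u , w≢v
  where
  unshift : {i j : Fin m} → 3 ↑ʳ i ≡ 3 ↑ʳ j → i ≡ j
  unshift = ↑ʳ-injective 3 _ _
  common : ∀ {a b c d : Fin m} → a ≡ c ⊎ a ≡ d ⊎ b ≡ c ⊎ b ≡ d →
    ∃[ u ] ((u ≡ 3 ↑ʳ a ⊎ u ≡ 3 ↑ʳ b) × (u ≡ 3 ↑ʳ c ⊎ u ≡ 3 ↑ʳ d))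
  common (inj₁ refl) = _ , inj₁ refl , inj₁ refl
  common (inj₂ (inj₁ refl)) = _ , inj₁ refl , inj₂ refl
  common (inj₂ (inj₂ (inj₁ refl))) = _ , inj₂ refl , inj₁ refl
  common (inj₂ (inj₂ (inj₂ refl))) = _ , inj₂ refl , inj₂ refl
  shared : ∀ {a b c d : Fin m} {u} → u ≡ 3 ↑ʳ a ⊎ u ≡ 3 ↑ʳ b → u ≡ 3 ↑ʳ c ⊎ u ≡ 3 ↑ʳ d →
    a ≡ c ⊎ a ≡ d ⊎ b ≡ c ⊎ b ≡ d
  shared (inj₁ e) (inj₁ e′) = inj₁ (unshift (trans (≡-sym e) e′))
  shared (inj₁ e) (inj₂ e′) = inj₂ (inj₁ (unshift (trans (≡-sym e) e′)))
  shared (inj₂ e) (inj₁ e′) = inj₂ (inj₂ (inj₁ (unshift (trans (≡-sym e) e′))))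
  shared (inj₂ e) (inj₂ e′) = inj₂ (inj₂ (inj₂ (unshift (trans (≡-sym e) e′))))
  third : (u v : Fin (3 + m)) → ∃[ w ] ((∀ i → w ≢ 3 ↑ʳ i) × w ≢ u × w ≢ v)
  -- Two given vertices exclude at most two of 0, 1, 2; the vertex 2 is taken only when 0 and 1 are
  -- both excluded.
  third u v with zero ≟ u | zero ≟ v | suc zero ≟ u | suc zero ≟ v
  ... | no z≢u | no z≢v | _ | _ = zero , (λ _ ()) , z≢u , z≢v
  ... | _ | _ | no o≢u | no o≢v = suc zero , (λ _ ()) , o≢u , o≢v
  ... | yes refl | _ | _ | yes refl = suc (suc zero) , (λ _ ()) , (λ ()) , (λ ())
  ... | _ | yes refl | yes refl | _ = suc (suc zero) , (λ _ ()) , (λ ()) , (λ ())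
  ... | yes refl | _ | yes () | _
  ... | _ | yes refl | _ | yes ()

-- Roots with a triangle

induced-diamond : ∀ {n} (H : Graph n) {z x y t} → Adj H z x → Adj H z y → Adj H x y →
  Adj H x t → Adj H y t → ¬ Adj H z t → z ≢ t → ContainsInducedDiamond H
induced-diamond {n} H {z} {x} {y} {t} zx zy xy xt yt z≁t z≢t = f , f-inj , f-adj
  where
  f : Fin 4 → Fin n
  f = lookup (z ∷ x ∷ y ∷ t ∷ [])
  pattern #0 = zero
  pattern #1 = suc zero
  pattern #2 = suc (suc zero)
  pattern #3 = suc (suc (suc zero))
  adj⇒≢ : ∀ {a b} → Adj H a b → a ≢ b
  adj⇒≢ ab refl = irrefl H ab
  f-inj : ∀ i j → f i ≡ f j → i ≡ j
  f-inj #0 #0 _ = refl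
  f-inj #0 #1 e = ⊥-elim (adj⇒≢ zx e)
  f-inj #0 #2 e = ⊥-elim (adj⇒≢ zy e)
  f-inj #0 #3 e = ⊥-elim (z≢t e)
  f-inj #1 #0 e = ⊥-elim (adj⇒≢ zx (≡-sym e))
  f-inj #1 #1 _ = refl
  f-inj #1 #2 e = ⊥-elim (adj⇒≢ xy e)
  f-inj #1 #3 e = ⊥-elim (adj⇒≢ xt e)
  f-inj #2 #0 e = ⊥-elim (adj⇒≢ zy (≡-sym e))
  f-inj #2 #1 e = ⊥-elim (adj⇒≢ xy (≡-sym e))
  f-inj #2 #2 _ = refl
  f-inj #2 #3 e = ⊥-elim (adj⇒≢ yt e)
  f-inj #3 #0 e = ⊥-elim (z≢t (≡-sym e))
  f-inj #3 #1 e = ⊥-elim (adj⇒≢ xt (≡-sym e))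
  f-inj #3 #2 e = ⊥-elim (adj⇒≢ yt (≡-sym e))
  f-inj #3 #3 _ = refl
  -- `DiamondAdj` computes to the unit or the empty type, so one pair of each kind stands for all
  -- pairs of that kind.
  present : ∀ {a b} → Adj H a b → Adj H a b ⇔ DiamondAdj #0 #1
  present ab = mk⇔ (λ _ → tt) (λ _ → ab)
  absent : ∀ {a b} → ¬ Adj H a b → Adj H a b ⇔ DiamondAdj #0 #0
  absent a≁b = mk⇔ a≁b ⊥-elim
  f-adj : ∀ i j → Adj H (f i) (f j) ⇔ DiamondAdj i j
  f-adj #0 #0 = absent (irrefl H)
  f-adj #0 #1 = present zx
  f-adj #0 #2 = present zy
  f-adj #0 #3 = absent z≁t
  f-adj #1 #0 = present (sym H zx)
  f-adj #1 #1 = absent (irrefl H)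
  f-adj #1 #2 = present xy
  f-adj #1 #3 = present xt
  f-adj #2 #0 = present (sym H zy)
  f-adj #2 #1 = present (sym H xy)
  f-adj #2 #2 = absent (irrefl H)
  f-adj #2 #3 = present yt
  f-adj #3 #0 = absent (z≁t ∘ sym H)
  f-adj #3 #1 = present (sym H xt)
  f-adj #3 #2 = present (sym H yt)
  f-adj #3 #3 = absent (irrefl H)

module _ {n k} {H : Graph n} (R : Root H k) where
  open Root R

  -- An edge `t` from `a` to some `d` other than `b` and `c` meets `x` and `y` at `a` but misses
  -- `z`. Then `z` and `t` are the nonadjacent vertices of an induced diamond.
  corner : ¬ ContainsInducedDiamond H → ∀ {x y z t a b c} →
    Joins x a b → Joins y a c → Joins z b c → At a t → t ≡ x ⊎ t ≡ y
  corner diamond-free {x} {y} {z} {t} {a} {b} {c} jx@(_ , _ , a≢b) jy@(_ , _ , a≢c) jz@(_ , _ , b≢c) a-at-t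
    with other-end a-at-t
  ... | d , jt with d ≟ b | d ≟ c
  ...   | yes refl | _ = inj₁ (unique jt jx)
  ...   | no _ | yes refl = inj₂ (unique jt jy)
  ...   | no d≢b | no d≢c = ⊥-elim (diamond-free (induced-diamond H
          (meet⇒adj jz (joins-sym jx) (≢-sym a≢c))
          (meet⇒adj (joins-sym jz) (joins-sym jy) (≢-sym a≢b))
          (meet⇒adj jx jy b≢c)
          (meet⇒adj jx jt (≢-sym d≢b))
          (meet⇒adj jy jt (≢-sym d≢c))
          (λ z~t → let (_ , u , u-at-z , u-at-t) = to (adj z t) z~t in disjoint u-at-z u-at-t)
          (λ { refl → disjoint a-at-t a-at-t })))
    where
    disjoint : ∀ {u} → At u z → ¬ At u t
    disjoint u-at-z u-at-t with at⇒end jz u-at-z | at⇒end jt u-at-t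
    ... | inj₁ refl | inj₁ b≡a = a≢b (≡-sym b≡a)
    ... | inj₁ refl | inj₂ b≡d = d≢b (≡-sym b≡d)
    ... | inj₂ refl | inj₁ c≡a = a≢c (≡-sym c≡a)
    ... | inj₂ refl | inj₂ c≡d = d≢c (≡-sym c≡d)

  -- By `corner` at all three corners, no edge outside the triangle meets one of its edges.
  -- Connectedness then leaves `H` only the pairwise adjacent vertices `x`, `y`, `z`.
  triangle⇒complete : ¬ ContainsInducedDiamond H → (∀ s t → Reach H s t) →
    ∀ {u v w} → Adj root u v → Adj root u w → Adj root v w → ∀ s t → s ≢ t → Adj H s t
  triangle⇒complete diamond-free reach {u} {v} {w}
    (x , jx@(_ , _ , u≢v)) (y , jy@(_ , _ , u≢w)) (z , jz@(_ , _ , v≢w)) =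
    λ s t → edges-adj (all-edges (reach x s) (inj₁ refl)) (all-edges (reach x t) (inj₁ refl))
    where
    TriangleEdge : Fin n → Set
    TriangleEdge t = t ≡ x ⊎ t ≡ y ⊎ t ≡ z
    u-edge : ∀ {t} → At u t → TriangleEdge t
    u-edge at = [ inj₁ , inj₂ ∘ inj₁ ]′ (corner diamond-free jx jy jz at)
    v-edge : ∀ {t} → At v t → TriangleEdge t
    v-edge at = [ inj₁ , inj₂ ∘ inj₂ ]′ (corner diamond-free (joins-sym jx) jz jy at)
    w-edge : ∀ {t} → At w t → TriangleEdge t
    w-edge at = [ inj₂ ∘ inj₁ , inj₂ ∘ inj₂ ]′
      (corner diamond-free (joins-sym jy) (joins-sym jz) jx at)
    next : ∀ {s t e} → TriangleEdge s → At e s → At e t → TriangleEdge t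
    next (inj₁ refl) e-at-s e-at-t with at⇒end jx e-at-s
    ... | inj₁ refl = u-edge e-at-t
    ... | inj₂ refl = v-edge e-at-t
    next (inj₂ (inj₁ refl)) e-at-s e-at-t with at⇒end jy e-at-s
    ... | inj₁ refl = u-edge e-at-t
    ... | inj₂ refl = w-edge e-at-t
    next (inj₂ (inj₂ refl)) e-at-s e-at-t with at⇒end jz e-at-s
    ... | inj₁ refl = v-edge e-at-t
    ... | inj₂ refl = w-edge e-at-t
    all-edges : ∀ {s t} → Reach H s t → TriangleEdge s → TriangleEdge t
    all-edges here s-edge = s-edge
    all-edges (step {s} {r} s~r path) s-edge with to (adj s r) s~r
    ... | _ , _ , e-at-s , e-at-r = all-edges path (next s-edge e-at-s e-at-r)
    xy : Adj H x y
    xy = meet⇒adj jx jy v≢w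
    xz : Adj H x z
    xz = meet⇒adj (joins-sym jx) jz u≢w
    yz : Adj H y z
    yz = meet⇒adj (joins-sym jy) (joins-sym jz) u≢v
    edges-adj : ∀ {s t} → TriangleEdge s → TriangleEdge t → s ≢ t → Adj H s t
    edges-adj (inj₁ refl) (inj₁ refl) s≢t = ⊥-elim (s≢t refl)
    edges-adj (inj₁ refl) (inj₂ (inj₁ refl)) _ = xy
    edges-adj (inj₁ refl) (inj₂ (inj₂ refl)) _ = xz
    edges-adj (inj₂ (inj₁ refl)) (inj₁ refl) _ = sym H xy
    edges-adj (inj₂ (inj₁ refl)) (inj₂ (inj₁ refl)) s≢t = ⊥-elim (s≢t refl)
    edges-adj (inj₂ (inj₁ refl)) (inj₂ (inj₂ refl)) _ = yz
    edges-adj (inj₂ (inj₂ refl)) (inj₁ refl) _ = sym H xz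
    edges-adj (inj₂ (inj₂ refl)) (inj₂ (inj₁ refl)) _ = sym H yz
    edges-adj (inj₂ (inj₂ refl)) (inj₂ (inj₂ refl)) s≢t = ⊥-elim (s≢t refl)

-- Triangle-free roots

module _ {n k} {H : Graph n} (R : Root H k)
  (triangle-free : Root.TriangleFree R) (three-lone : Root.ThreeLone R) where
  open Root R

  -- Joining all isolated vertices, of which there are at least three, to each
  -- other leaves no vertex isolated and creates no maximal clique of size 2.
  filled : Graph k
  filled = record
    { Adj = λ u v → Adj root u v ⊎ (u ≢ v × Lone u × Lone v)
    ; sym = λ { (inj₁ e) → inj₁ (sym root e) ; (inj₂ (u≢v , lu , lv)) → inj₂ (≢-sym u≢v , lv , lu) }
    ; irrefl = λ { (inj₁ e) → irrefl root e ; (inj₂ (u≢u , _)) → u≢u refl }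
    }

  neighbour? : ∀ u → Dec (∃[ v ] Adj root u v)
  neighbour? u = any? (root-adj? u)

  filled-adj? : ∀ u v → Dec (Adj filled u v)
  filled-adj? u v =
    root-adj? u v ⊎-dec (¬? (u ≟ v) ×-dec (¬? (neighbour? u) ×-dec ¬? (neighbour? v)))

  filled-neighbour : ∀ u → ∃[ v ] Adj filled u v
  filled-neighbour u with neighbour? u
  ... | yes (v , e) = v , inj₁ e
  -- Only one vertex has to be avoided, so `u` is passed twice.
  ... | no lone = let (w , w-lone , w≢u , _) = three-lone u u in w , inj₂ (≢-sym w≢u , lone , w-lone)

  -- The ends of a root edge are not isolated, so every edge of `filled` at them is a root edge, and
  -- a triangle on this edge would lie in the root.
  adj⇒MaxEdge : ∀ {u v} → Adj root u v → MaxEdge filled u v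
  adj⇒MaxEdge {u} {v} e = inj₁ e , maximal
    where
    maximal : ∀ w → Adj filled u w → ¬ Adj filled v w
    maximal w (inj₂ (_ , u-lone , _)) _ = u-lone (_ , e)
    maximal w _ (inj₂ (_ , v-lone , _)) = v-lone (_ , sym root e)
    maximal w (inj₁ uw) (inj₁ vw) = triangle-free _ _ _ e uw vw

  MaxEdge⇒adj : ∀ {u v} → MaxEdge filled u v → Adj root u v
  MaxEdge⇒adj (inj₁ e , _) = e
  MaxEdge⇒adj {u} {v} (inj₂ (_ , u-lone , v-lone) , maximal) =
    let (w , w-lone , w≢u , w≢v) = three-lone u v in
    ⊥-elim (maximal w (inj₂ (≢-sym w≢u , u-lone , w-lone)) (inj₂ (≢-sym w≢v , v-lone , w-lone)))

  ends : Fin n → Subset k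
  ends x = pair (p x) (q x)

  ∈ends⇒at : ∀ {u x} → u ∈ ends x → At u x
  ∈ends⇒at = ∈pair⁻

  at⇒∈ends : ∀ {u x} → At u x → u ∈ ends x
  at⇒∈ends = ∈pair⁺

  joins⇒ends≡ : ∀ {x u v} → Joins x u v → ends x ≡ pair u v
  joins⇒ends≡ j@(u-at , v-at , _) =
    ⊆-antisym (∈pair⁺ ∘ at⇒end j ∘ ∈ends⇒at) (pair⊆ (at⇒∈ends u-at) (at⇒∈ends v-at))

  ends-injective : ∀ x y → ends x ≡ ends y → x ≡ y
  ends-injective x y eq with joins-ends x
  ... | j@(p-at , q-at , p≢q) = unique j
    (∈ends⇒at (subst (p x ∈_) eq (at⇒∈ends p-at)) , ∈ends⇒at (subst (q x ∈_) eq (at⇒∈ends q-at)) , p≢q)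

  -- Two edges with common end `a` differ by exchanging their other ends `b` and `c`. As the edge
  -- from `a` to `b` lies in no triangle, `b` and `c` are nonadjacent in `filled`, hence adjacent in
  -- the complement.
  adj⇒IAdj : ∀ {x y} → Adj H x y → IAdj (complement filled) (ends x) (ends y)
  adj⇒IAdj {x} {y} x~y with to (adj x y) x~y
  ... | x≢y , a , a-at-x , a-at-y with other-end a-at-x | other-end a-at-y
  ... | b , jx@(_ , b-at-x , a≢b) | c , jy@(_ , _ , a≢c) =
    b , c , at⇒∈ends b-at-x , c∉x , (b≢c , b≁c) ,
    trans (joins⇒ends≡ jy) (trans (≡-sym (swap-pair a≢b)) (cong (λ X → swap X b c) (≡-sym (joins⇒ends≡ jx))))
    where
    b≢c : b ≢ c
    b≢c refl = x≢y (unique jx jy)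
    b≁c : ¬ Adj filled b c
    b≁c = proj₂ (adj⇒MaxEdge (x , jx)) c (inj₁ (y , jy))
    c∉x : c ∉ ends x
    c∉x c∈x with at⇒end jx (∈ends⇒at c∈x)
    ... | inj₁ c≡a = a≢c (≡-sym c≡a)
    ... | inj₂ c≡b = b≢c (≡-sym c≡b)

  -- The end of `x` that is not exchanged survives as an end of `y`.
  IAdj⇒adj : ∀ {x y} → IAdj (complement filled) (ends x) (ends y) → Adj H x y
  IAdj⇒adj {x} {y} (u , v , u∈x , v∉x , _ , y≡) with other-end (∈ends⇒at u∈x)
  ... | a , _ , a-at-x , u≢a = from (adj x y) (x≢y , a , a-at-x ,
        ∈ends⇒at (subst (a ∈_) (≡-sym y≡) (∈swap-old (at⇒∈ends a-at-x) (≢-sym u≢a))))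
    where
    x≢y : x ≢ y
    x≢y refl = v∉x (subst (v ∈_) (≡-sym y≡) (∈swap-new {X = ends x}))

  triangle-free⇒IGraph : Fin n → IsIGraph H
  triangle-free⇒IGraph x₀ = k , complement filled , ends ,
    (λ x → MaxEdge⇒ISet filled filled-adj? filled-neighbour (maxEdge x)) , ends-injective , surj ,
    λ x y → mk⇔ adj⇒IAdj IAdj⇒adj
    where
    maxEdge : ∀ x → MaxEdge filled (p x) (q x)
    maxEdge x = adj⇒MaxEdge (x , joins-ends x)
    surj : ∀ T → IsISet (complement filled) T → ∃[ x ] ends x ≡ T
    -- The edge `x₀` is the maximal clique of size 2 that fixes the size of all i-sets.
    surj T T-iset with ISet⇒MaxEdge filled filled-adj? filled-neighbour (maxEdge x₀) T-iset
    ... | _ , _ , e , T≡ = let (x , j) = MaxEdge⇒adj e in x , trans (joins⇒ends≡ j) (≡-sym T≡)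

-- The characterisation, by cases on a triangle in the root graph

mainTheorem2 : ∀ {n} (H : Graph n) → Connected H → IsLineGraph H →
    (IsIGraph H ⇔ (¬ ContainsInducedDiamond H))
mainTheorem2 H (x₀ , reach) line = mk⇔ (IGraph⇒diamond-free {H = H}) diamond-free⇒IGraph
  where
  diamond-free⇒IGraph : ¬ ContainsInducedDiamond H → IsIGraph H
  diamond-free⇒IGraph diamond-free with LineGraph⇒Root line
  -- Root adjacency is decidable and the vertex set finite, so the existence of a triangle can be
  -- decided by search.
  ... | _ , R , three-lone with any? (λ u → any? λ v → any? λ w →
        Root.root-adj? R u v ×-dec (Root.root-adj? R u w ×-dec Root.root-adj? R v w))
  ... | yes (_ , _ , _ , uv , uw , vw) =
        complete⇒IGraph H x₀ (triangle⇒complete R diamond-free reach uv uw vw)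
  ... | no no-triangle = triangle-free⇒IGraph R
        (λ u v w uv uw vw → no-triangle (u , v , w , uv , uw , vw)) three-lone x₀
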